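{- Let $n>2$ and $t>2$ be two positive integers. Then \[\varphi(P_n\boxdot P_t)=\begin{cases} 4, & \text{if } n=3 \text{ and } t\in\{3,4\},\\ 5, & \text{if either } (n=3 \text{ and } t\geq 5) \text{ or } n\in\{4,5\},\\ n-1, & \text{if } 6\leq n\leq 2t+3,\\ 2t+3, & \text{otherwise (that is, if } n>2t+3 \text{ and none of the previous cases applies)}. \end{cases}\]
   Context: All graphs are finite and simple. $P_n$ denotes the path with $n$ vertices. The subdivision graph $S(G)$ of a graph $G$ is obtained by inserting one new vertex into every edge of $G$. For graphs $G$ and $H$, with $V(G)=\{u_0,\ldots,u_{m-1}\}$, the subdivision-vertex neighbourhood corona (SVN corona) $G\boxdot H$ is the graph obtained from $S(G)$ by adding $m$ vertex-disjoint copies of $H$ (one for each $u_i$) and joining, for each $i$, every vertex of $N_{S(G)}(u_i)$ (the neighbourhood of $u_i$ in $S(G)$) to every vertex of the copy of $H$ associated with $u_i$. A $b$-chromatic coloring of a graph with $k$ colors is a proper coloring with colors $0,\ldots,k-1$ such that, for each color $i$, there is a vertex (a $b$-vertex) of color $i$ having, for each color $j\neq i$, a neighbour of color $j$. The $b$-chromatic number $\varphi(G)$ is the maximum $k$ for which $G$ has a $b$-chromatic coloring with $k$ colors. -}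

module Defs where

open import Data.Empty using (⊥; ⊥-elim-irr)
open import Data.Fin using (Fin; zero; suc; toℕ)
open import Data.Fin.Properties using (+↔⊎; *↔×; _<?_; inj⇒≟)
import Data.Fin as Fin
open import Data.Irrelevant using ([_])
open import Data.Nat using (ℕ; zero; suc; _+_; _*_; _≤_)
import Data.Nat.Properties as ℕ
open import Data.Product using (Σ; ∃; _×_; _,_; proj₁; proj₂)
open import Data.Product.Function.NonDependent.Propositional using (_×-↔_)
open import Data.Refinement using (Refinement-syntax; value; _,_; value-injective)
open import Data.Sum using (_⊎_; inj₁; inj₂; swap)
open import Data.Sum.Function.Propositional using (_⊎-↔_)
open import Function using (_∘_; _↔_; Inverse; mk↔ₛ′)
open import Function.Construct.Composition using (_↔-∘_)
open import Function.Construct.Identity using (↔-id)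
open import Function.Construct.Symmetry using (↔-sym)
open import Function.Properties.Inverse using (↔⇒↣)
open import Relation.Binary.Definitions
  using (Symmetric; Irreflexive; Decidable; DecidableEquality)
open import Relation.Binary.PropositionalEquality
  using (_≡_; _≢_; refl; sym; cong; subst)
open import Relation.Nullary using (yes; no)
open import Relation.Nullary.Decidable using (_×-dec_; _⊎-dec_)
import Relation.Unary as U


Finite : Set → Set
Finite A = ∃ λ n → A ↔ Fin n

finite-Fin : ∀ n → Finite (Fin n)
finite-Fin n = n , ↔-id (Fin n)

finite-⊎ : ∀ {A B} → Finite A → Finite B → Finite (A ⊎ B)
finite-⊎ (m , A↔) (n , B↔) = m + n , ↔-sym +↔⊎ ↔-∘ (A↔ ⊎-↔ B↔)

finite-× : ∀ {A B} → Finite A → Finite B → Finite (A × B)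
finite-× (m , A↔) (n , B↔) = m * n , ↔-sym *↔× ↔-∘ (A↔ ×-↔ B↔)

private
  refinement-cong : ∀ {A B : Set} (A↔B : A ↔ B) (P : A → Set) →
                    [ a ∈ A ∣ P a ] ↔ [ b ∈ B ∣ P (Inverse.from A↔B b) ]
  refinement-cong {A} {B} A↔B P = mk↔ₛ′
    (λ { (a , [ p ]) → to a , [ subst P (sym (strictlyInverseʳ a)) p ] })
    (λ { (b , [ p ]) → from b , [ p ] })
    (λ b → value-injective (strictlyInverseˡ (value b)))
    (λ a → value-injective (strictlyInverseʳ (value a)))
    where open Inverse A↔B

  refinement-suc-yes : ∀ {n k} {P : Fin (suc n) → Set} → P zero →
                       [ i ∈ Fin n ∣ P (suc i) ] ↔ Fin k →
                       [ i ∈ Fin (suc n) ∣ P i ] ↔ Fin (suc k)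
  refinement-suc-yes {n} {k} {P} p₀ r = mk↔ₛ′ f g f∘g g∘f
    where
    open Inverse r
    f : [ i ∈ Fin (suc n) ∣ P i ] → Fin (suc k)
    f (zero  , _)     = zero
    f (suc i , [ p ]) = suc (to (i , [ p ]))
    lift : [ i ∈ Fin n ∣ P (suc i) ] → [ i ∈ Fin (suc n) ∣ P i ]
    lift (i , [ p ]) = suc i , [ p ]
    g : Fin (suc k) → [ i ∈ Fin (suc n) ∣ P i ]
    g zero    = zero , [ p₀ ]
    g (suc j) = lift (from j)
    f∘g : ∀ j → f (g j) ≡ j
    f∘g zero    = refl
    f∘g (suc j) = cong suc (strictlyInverseˡ j)
    g∘f : ∀ x → g (f x) ≡ x
    g∘f (zero  , [ _ ]) = refl
    g∘f (suc i , [ p ]) = cong lift (strictlyInverseʳ (i , [ p ]))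

  refinement-suc-no : ∀ {n k} {P : Fin (suc n) → Set} → (P zero → ⊥) →
                      [ i ∈ Fin n ∣ P (suc i) ] ↔ Fin k →
                      [ i ∈ Fin (suc n) ∣ P i ] ↔ Fin k
  refinement-suc-no {n} {k} {P} ¬p₀ r = mk↔ₛ′ f g f∘g g∘f
    where
    open Inverse r
    f : [ i ∈ Fin (suc n) ∣ P i ] → Fin k
    f (zero  , [ p ]) = ⊥-elim-irr (¬p₀ p)
    f (suc i , [ p ]) = to (i , [ p ])
    lift : [ i ∈ Fin n ∣ P (suc i) ] → [ i ∈ Fin (suc n) ∣ P i ]
    lift (i , [ p ]) = suc i , [ p ]
    g : Fin k → [ i ∈ Fin (suc n) ∣ P i ]
    g j = lift (from j)
    f∘g : ∀ j → f (g j) ≡ j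
    f∘g j = strictlyInverseˡ j
    g∘f : ∀ x → g (f x) ≡ x
    g∘f (zero  , [ p ]) = ⊥-elim-irr (¬p₀ p)
    g∘f (suc i , [ p ]) = cong lift (strictlyInverseʳ (i , [ p ]))

  finite-refinement-Fin : ∀ n {P : Fin n → Set} → U.Decidable P →
                          Finite [ i ∈ Fin n ∣ P i ]
  finite-refinement-Fin zero P? =
    zero , mk↔ₛ′ value (λ ()) (λ ()) (λ { (() , _) })
  finite-refinement-Fin (suc n) P?
    with P? zero | finite-refinement-Fin n (P? ∘ suc)
  ... | yes p₀ | k , r = suc k , refinement-suc-yes p₀ r
  ... | no ¬p₀ | k , r = k , refinement-suc-no ¬p₀ r

finite-refinement : ∀ {A : Set} {P : A → Set} → Finite A → U.Decidable P →
                    Finite [ a ∈ A ∣ P a ]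
finite-refinement {P = P} (n , A↔) P? =
  let k , r = finite-refinement-Fin n (P? ∘ Inverse.from A↔)
  in  k , r ↔-∘ refinement-cong A↔ P


record Graph : Set₁ where
  field
    V      : Set
    finite : Finite V
    Adj    : V → V → Set
    adj?   : Decidable Adj
    symm   : Symmetric Adj
    irrefl : Irreflexive _≡_ Adj

  index : V → Fin (proj₁ finite)
  index = Inverse.to (proj₂ finite)

  _≟ᵛ_ : DecidableEquality V
  _≟ᵛ_ = inj⇒≟ (↔⇒↣ (proj₂ finite))

  -- An edge {u , v} is stored once, as the pair (u , v) with index u < index v.
  -- The proofs are irrelevant, so distinct edges have distinct endpoint pairs.
  Edge : Set
  Edge = [ (u , v) ∈ V × V ∣ index u Fin.< index v × Adj u v ]

  _∈ᵉ_ : V → Edge → Set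
  w ∈ᵉ e = w ≡ proj₁ (value e) ⊎ w ≡ proj₂ (value e)

  _∈ᵉ?_ : Decidable _∈ᵉ_
  w ∈ᵉ? e = (w ≟ᵛ proj₁ (value e)) ⊎-dec (w ≟ᵛ proj₂ (value e))

  finite-Edge : Finite Edge
  finite-Edge = finite-refinement (finite-× finite finite)
    (λ (u , v) → (index u <? index v) ×-dec adj? u v)

open Graph

path : ℕ → Graph
path n = record
  { V      = Fin n
  ; finite = finite-Fin n
  ; Adj    = λ i j → suc (toℕ i) ≡ toℕ j ⊎ suc (toℕ j) ≡ toℕ i
  ; adj?   = λ i j → (suc (toℕ i) ℕ.≟ toℕ j) ⊎-dec (suc (toℕ j) ℕ.≟ toℕ i)
  ; symm   = swap
  ; irrefl = λ { refl (inj₁ p) → ℕ.1+n≢n p ; refl (inj₂ p) → ℕ.1+n≢n p }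
  }

module _ (G : Graph) where

  SubdivisionAdj : V G ⊎ Edge G → V G ⊎ Edge G → Set
  SubdivisionAdj (inj₁ u) (inj₁ v) = ⊥
  SubdivisionAdj (inj₁ u) (inj₂ e) = _∈ᵉ_ G u e
  SubdivisionAdj (inj₂ e) (inj₁ u) = _∈ᵉ_ G u e
  SubdivisionAdj (inj₂ e) (inj₂ f) = ⊥

  subdivision : Graph
  subdivision = record
    { V      = V G ⊎ Edge G
    ; finite = finite-⊎ (finite G) (finite-Edge G)
    ; Adj    = SubdivisionAdj
    ; adj?   = λ where
        (inj₁ u) (inj₁ v) → no λ ()
        (inj₁ u) (inj₂ e) → _∈ᵉ?_ G u e
        (inj₂ e) (inj₁ u) → _∈ᵉ?_ G u e
        (inj₂ e) (inj₂ f) → no λ ()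
    ; symm   = λ {x} {y} → symmetric x y
    ; irrefl = λ { {inj₁ _} refl () ; {inj₂ _} refl () }
    }
    where
    symmetric : ∀ x y → SubdivisionAdj x y → SubdivisionAdj y x
    symmetric (inj₁ u) (inj₂ e) p = p
    symmetric (inj₂ e) (inj₁ u) p = p

module _ (G H : Graph) where

  private
    S = subdivision G

  -- inj₂ (u , h) is the vertex h in the copy of H associated with u.
  CoronaAdj : V S ⊎ (V G × V H) → V S ⊎ (V G × V H) → Set
  CoronaAdj (inj₁ x)       (inj₁ y)        = Adj S x y
  CoronaAdj (inj₁ x)       (inj₂ (u , h))  = Adj S (inj₁ u) x
  CoronaAdj (inj₂ (u , h)) (inj₁ x)        = Adj S (inj₁ u) x
  CoronaAdj (inj₂ (u , h)) (inj₂ (v , h′)) = u ≡ v × Adj H h h′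

  infix 6 _⊡_

  _⊡_ : Graph
  _⊡_ = record
    { V      = V S ⊎ (V G × V H)
    ; finite = finite-⊎ (finite S) (finite-× (finite G) (finite H))
    ; Adj    = CoronaAdj
    ; adj?   = λ where
        (inj₁ x)       (inj₁ y)        → adj? S x y
        (inj₁ x)       (inj₂ (u , h))  → adj? S (inj₁ u) x
        (inj₂ (u , h)) (inj₁ x)        → adj? S (inj₁ u) x
        (inj₂ (u , h)) (inj₂ (v , h′)) → _≟ᵛ_ G u v ×-dec adj? H h h′
    ; symm   = λ {x} {y} → symmetric x y
    ; irrefl = λ { {inj₁ _} refl p       → irrefl S refl p
                 ; {inj₂ _} refl (_ , p) → irrefl H refl p }
    }
    where
    symmetric : ∀ x y → CoronaAdj x y → CoronaAdj y x
    symmetric (inj₁ x) (inj₁ y) p       = symm S {x} {y} p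
    symmetric (inj₁ x) (inj₂ _) p       = p
    symmetric (inj₂ _) (inj₁ x) p       = p
    symmetric (inj₂ _) (inj₂ _) (e , p) = sym e , symm H p


module _ (G : Graph) where

  Proper : ∀ {k} → (V G → Fin k) → Set
  Proper c = ∀ u v → Adj G u v → c u ≢ c v

  IsBVertex : ∀ {k} → (V G → Fin k) → Fin k → V G → Set
  IsBVertex c i v = c v ≡ i × (∀ j → j ≢ i → ∃ λ w → Adj G v w × c w ≡ j)

  IsBChromatic : ∀ {k} → (V G → Fin k) → Set
  IsBChromatic c = Proper c × (∀ i → ∃ λ v → IsBVertex c i v)

  HasBColoring : ℕ → Set
  HasBColoring k = Σ (V G → Fin k) IsBChromatic

-- φ G ≔ k means that k is the maximum number of colors in a b-chromatic
-- coloring of G.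
infix 4 φ_≔_

φ_≔_ : Graph → ℕ → Set
φ G ≔ k = HasBColoring G k × (∀ l → HasBColoring G l → l ≤ k)

{-# OPTIONS --safe #-}

-- The subdivision vertices have degree 2t + 2 and every other vertex has degree
-- at most 4, so a b-chromatic coloring with six or more colors takes its
-- b-vertices among the n - 1 subdivision vertices; for n = 3 and t ≤ 4 at most
-- four vertices have degree at least 4, which excludes five colors.  Conversely,
-- let block i consist of u_i and its copy of P_t, t + 1 vertices in all, and let
-- e_i subdivide the edge u_i u_{i+1}.  If e_i has color i for all i, then the
-- blocks are essentially forced: block i gets the colors c < i - 1 with c ≡ i and
-- the colors c > i with c ≢ i modulo 2.
module Submission where

open import Defs
open import Data.Empty using (⊥)
open import Data.Fin using (Fin; toℕ; fromℕ; fromℕ<; inject₁)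
import Data.Fin as Fin
open import Data.Fin.Patterns using (0F; 1F; 2F; 3F; 4F)
open import Data.Fin.Properties
  using (toℕ-fromℕ<; toℕ-injective; toℕ<n; fromℕ<-injective; inject₁-injective;
         fromℕ≢inject₁; injective⇒≤)
  renaming (suc-injective to Fin-suc-injective)
open import Data.Irrelevant using ([_])
open import Data.Nat
  using (ℕ; zero; suc; _+_; _*_; _∸_; _≤_; _<_; _>_; _≥_; _⊓_; z≤n; s≤s; z<s; ⌈_/2⌉; _<?_; _≤?_)
open import Data.Nat.Properties
open import Data.Product using (∃; _×_; _,_; proj₁; proj₂)
open import Data.Product.Properties using (,-injectiveˡ; ,-injectiveʳ)
open import Data.Refinement using (value; _,_; value-injective)
open import Data.Sum using (_⊎_; inj₁; inj₂; [_,_]′)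
import Data.Sum as Sum
open import Data.Sum.Properties using (inj₁-injective; inj₂-injective)
open import Data.Unit using (⊤; tt)
open import Function using (_∘_; Inverse; Injection)
open import Function.Properties.Inverse using (↔⇒↣)
open import Relation.Binary.PropositionalEquality
  using (_≡_; _≢_; refl; sym; trans; cong; cong₂; subst; subst₂)
open import Relation.Nullary using (¬_; Dec; yes; no; contradiction; recompute)

open Graph

pattern branch u = inj₁ (inj₁ u)
pattern sub e    = inj₁ (inj₂ e)
pattern leaf u h = inj₂ (u , h)

-- Edges of a path, determined by either endpoint.

module _ {n : ℕ} where

  left right : Edge (path n) → Fin n
  left  = proj₁ ∘ value
  right = proj₂ ∘ value

  suc-left : ∀ e → suc (toℕ (left e)) ≡ toℕ (right e)
  -- The proof `p` is irrelevant, but equality of naturals is decidable, so the equation can be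
  -- recomputed.
  suc-left ((u , v) , [ p ]) = recompute (suc (toℕ u) ≟ toℕ v) (ascending p)
    where
    ascending : (toℕ u < toℕ v) × Adj (path n) u v → suc (toℕ u) ≡ toℕ v
    ascending (u<v , inj₁ eq) = eq
    ascending (u<v , inj₂ eq) = contradiction (≤-trans u<v (≤-trans (n≤1+n _) (≤-reflexive eq))) (<-irrefl refl)

  left-bound : ∀ e → toℕ (left e) < n ∸ 1
  left-bound e = ∸-monoˡ-≤ 1 (subst (_< n) (sym (suc-left e)) (toℕ<n (right e)))

  left-injective : ∀ {e f} → left e ≡ left f → e ≡ f
  left-injective {e} {f} eq = value-injective (cong₂ _,_ eq
    (toℕ-injective (trans (sym (suc-left e)) (trans (cong (suc ∘ toℕ) eq) (suc-left f)))))

  right-injective : ∀ {e f} → right e ≡ right f → e ≡ f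
  right-injective {e} {f} eq = left-injective (toℕ-injective (suc-injective
    (trans (suc-left e) (trans (cong toℕ eq) (sym (suc-left f))))))

  edge : ∀ i → suc i < n → Edge (path n)
  edge i 1+i<n = (fromℕ< i<n , fromℕ< 1+i<n) ,
    [ subst₂ _<_ (sym (toℕ-fromℕ< i<n)) (sym (toℕ-fromℕ< 1+i<n)) (n<1+n i)
    , inj₁ (trans (cong suc (toℕ-fromℕ< i<n)) (sym (toℕ-fromℕ< 1+i<n))) ]
    where
    i<n : i < n
    i<n = <-trans (n<1+n i) 1+i<n

  left-edge : ∀ i 1+i<n → toℕ (left (edge i 1+i<n)) ≡ i
  left-edge i 1+i<n = toℕ-fromℕ< _

  right-edge : ∀ i 1+i<n → toℕ (right (edge i 1+i<n)) ≡ suc i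
  right-edge i 1+i<n = toℕ-fromℕ< _

-- Lower bounds

-- Slot j < t of block i is the vertex j of the copy of P_t, slot t is u_i.
module BlockColoring {n t k : ℕ} (E : ℕ → Fin k) (B : ℕ → ℕ → Fin k) where

  private
    G = path n ⊡ path t

  color : V G → Fin k
  color (branch u) = B (toℕ u) t
  color (sub e)    = E (toℕ (left e))
  color (leaf u h) = B (toℕ u) (toℕ h)

  module _ (E≢Bˡ : ∀ i j → E i ≢ B i j) (E≢Bʳ : ∀ i j → E i ≢ B (suc i) j)
           (B≢B : ∀ i j → B i j ≢ B i (suc j)) where

    -- e_i meets blocks i and i + 1 only, so the two hypotheses on `E` and `B` cover every conflict
    -- between a subdivision vertex and a block.
    color-incident : ∀ {u} e j → _∈ᵉ_ (path n) u e → color (sub e) ≢ B (toℕ u) j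
    color-incident e j (inj₁ refl) = E≢Bˡ _ j
    color-incident e j (inj₂ refl) =
      subst (λ i → color (sub e) ≢ B i j) (suc-left e) (E≢Bʳ _ j)

    color-proper : Proper G color
    color-proper (branch u) (sub e)    p eq = color-incident e t p (sym eq)
    color-proper (sub e)    (branch u) p eq = color-incident e t p eq
    color-proper (sub e)    (leaf u h) p eq = color-incident e (toℕ h) p eq
    color-proper (leaf u h) (sub e)    p eq = color-incident e (toℕ h) p (sym eq)
    color-proper (leaf u h) (leaf .u h′) (refl , inj₁ p) eq =
      B≢B (toℕ u) (toℕ h) (trans eq (cong (B (toℕ u)) (sym p)))
    color-proper (leaf u h) (leaf .u h′) (refl , inj₂ p) eq =
      B≢B (toℕ u) (toℕ h′) (trans (sym eq) (cong (B (toℕ u)) (sym p)))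

  -- A copy is joined to the neighborhood of its u_i, so u_i and all vertices of the copy see the
  -- same subdivision vertices; a block thus serves as a uniform supply of neighbors.
  slot : ∀ u {j} → j ≤ t →
         ∃ λ w → (∀ e → _∈ᵉ_ (path n) u e → Adj G (sub e) w) × color w ≡ B (toℕ u) j
  slot u {j} j≤t with m≤n⇒m<n∨m≡n j≤t
  ... | inj₁ j<t  = leaf u (fromℕ< j<t) , (λ _ p → p) , cong (B (toℕ u)) (toℕ-fromℕ< j<t)
  ... | inj₂ refl = branch u , (λ _ p → p) , refl

  -- The neighborhood of e_i consists of blocks i and i + 1, with slots up to and including t.
  sub-bvertex : ∀ {i} → suc i < n →
                (∀ c → c ≢ E i → ∃ λ j → j ≤ t × (B i j ≡ c ⊎ B (suc i) j ≡ c)) →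
                ∃ (IsBVertex G color (E i))
  sub-bvertex {i} 1+i<n covers = sub e , cong E (left-edge i 1+i<n) , neighbor
    where
    e = edge i 1+i<n
    neighbor : ∀ c → c ≢ E i → ∃ λ w → Adj G (sub e) w × color w ≡ c
    neighbor c c≢ with covers c c≢
    ... | j , j≤t , inj₁ eq = let w , adj , col = slot (left e) j≤t in
      w , adj e (inj₁ refl) , trans col (trans (cong (λ x → B x j) (left-edge i 1+i<n)) eq)
    ... | j , j≤t , inj₂ eq = let w , adj , col = slot (right e) j≤t in
      w , adj e (inj₂ refl) , trans col (trans (cong (λ x → B x j) (right-edge i 1+i<n)) eq)

  -- The block index is `suc i` so that edges on both sides exist. A leaf sees these two subdivision
  -- vertices and its neighbors in the copy, but not the branch vertex, hence `j′ < t` instead of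
  -- `j′ ≤ t`.
  leaf-bvertex : ∀ {i j} → suc (suc i) < n → j < t →
                 (∀ c → c ≢ B (suc i) j → (E i ≡ c ⊎ E (suc i) ≡ c) ⊎
                    ∃ λ j′ → j′ < t × (suc j ≡ j′ ⊎ suc j′ ≡ j) × B (suc i) j′ ≡ c) →
                 ∃ (IsBVertex G color (B (suc i) j))
  leaf-bvertex {i} {j} 2+i<n j<t covers = leaf u h , cong₂ B toℕ-u toℕ-h , neighbor
    where
    1+i<n = <-trans (n<1+n (suc i)) 2+i<n
    e = edge i 1+i<n
    f = edge (suc i) 2+i<n
    u = right e
    h = fromℕ< j<t
    toℕ-u : toℕ u ≡ suc i
    toℕ-u = right-edge i 1+i<n
    toℕ-h : toℕ h ≡ j
    toℕ-h = toℕ-fromℕ< j<t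
    u≡left-f : u ≡ left f
    u≡left-f = toℕ-injective (trans toℕ-u (sym (left-edge (suc i) 2+i<n)))
    neighbor : ∀ c → c ≢ B (suc i) j → ∃ λ w → Adj G (leaf u h) w × color w ≡ c
    neighbor c c≢ with covers c c≢
    ... | inj₁ (inj₁ eq) = sub e , inj₂ refl , trans (cong E (left-edge i 1+i<n)) eq
    ... | inj₁ (inj₂ eq) = sub f , inj₁ u≡left-f , trans (cong E (left-edge (suc i) 2+i<n)) eq
    ... | inj₂ (j′ , j′<t , adj , eq) =
      leaf u (fromℕ< j′<t) ,
      (refl , subst₂ (λ x y → suc x ≡ y ⊎ suc y ≡ x) (sym toℕ-h) (sym (toℕ-fromℕ< j′<t)) adj) ,
      trans (cong₂ B toℕ-u (toℕ-fromℕ< j′<t)) eq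

-- Parity and the palettes of the blocks

par : ℕ → ℕ
par 0             = 0
par 1             = 1
par (suc (suc i)) = par i

par≤1 : ∀ i → par i ≤ 1
par≤1 0             = z≤n
par≤1 1             = ≤-refl
par≤1 (suc (suc i)) = par≤1 i

par-suc : ∀ i → par i ≢ par (suc i)
par-suc 0             ()
par-suc 1             ()
par-suc (suc (suc i)) = par-suc i

par-idem : ∀ i → par (par i) ≡ par i
par-idem 0             = refl
par-idem 1             = refl
par-idem (suc (suc i)) = par-idem i

par-covers : ∀ i {c} → c ≤ 1 → par i ≡ c ⊎ par (suc i) ≡ c
par-covers 0             z≤n       = inj₁ refl
par-covers 0             (s≤s z≤n) = inj₂ refl
par-covers 1             z≤n       = inj₂ refl
par-covers 1             (s≤s z≤n) = inj₁ refl
par-covers (suc (suc i)) c≤1       = par-covers i c≤1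

-- The least color of the palette of i.
seed : ℕ → ℕ
seed 0             = 1
seed 1             = 2
seed (suc (suc i)) = par i

-- Dropping the least color and subtracting two from the others turns the palette of i into that of
-- i - 2; the palettes of 0 and 1 reproduce themselves.
down : ℕ → ℕ
down 0             = 0
down 1             = 1
down (suc (suc i)) = i

-- palette i enumerates increasingly the c < i - 1 with c ≡ i and the c > i with
-- c ≢ i modulo 2.
palette : ℕ → ℕ → ℕ
palette i zero    = seed i
palette i (suc j) = 2 + palette (down i) j

-- Together with `palette≢ʳ` this keeps the color i of e_i out of both blocks that e_i meets. The
-- recursion lowers color and index by two at once.
palette≢ˡ : ∀ i j → palette i j ≢ i
palette≢ˡ 0             zero    ()
palette≢ˡ 0             (suc j) ()
palette≢ˡ 1             zero    ()
palette≢ˡ 1             (suc j) ()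
palette≢ˡ (suc (suc i)) zero    eq = contradiction (subst (_≤ 1) eq (par≤1 i)) λ { (s≤s ()) }
palette≢ˡ (suc (suc i)) (suc j) eq = palette≢ˡ i j (suc-injective (suc-injective eq))

palette≢ʳ : ∀ i j → palette (suc i) j ≢ i
palette≢ʳ 0             zero    ()
palette≢ʳ 0             (suc j) ()
palette≢ʳ 1             zero    ()
palette≢ʳ 1             (suc j) ()
palette≢ʳ (suc (suc i)) zero    eq = contradiction (subst (_≤ 1) eq (par≤1 (suc i))) λ { (s≤s ()) }
palette≢ʳ (suc (suc i)) (suc j) eq = palette≢ʳ i j (suc-injective (suc-injective eq))

seed≢palette-suc : ∀ i j → seed i ≢ palette i (suc j)
seed≢palette-suc 0             j ()
-- Equality would make `palette 1 j` equal to 0, the color of e_0, which block 1 avoids.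
seed≢palette-suc 1             j eq = palette≢ʳ 0 j (sym (suc-injective (suc-injective eq)))
seed≢palette-suc (suc (suc i)) j eq = contradiction (subst (_≤ 1) eq (par≤1 i)) λ { (s≤s ()) }

palette-injective : ∀ i {j j′} → palette i j ≡ palette i j′ → j ≡ j′
palette-injective i {zero}  {zero}   eq = refl
palette-injective i {zero}  {suc j′} eq = contradiction eq (seed≢palette-suc i j′)
palette-injective i {suc j} {zero}   eq = contradiction (sym eq) (seed≢palette-suc i j)
palette-injective i {suc j} {suc j′} eq =
  cong suc (palette-injective (down i) (suc-injective (suc-injective eq)))

seed≤2 : ∀ i → seed i ≤ 2
seed≤2 0             = s≤s z≤n
seed≤2 1             = ≤-refl
seed≤2 (suc (suc i)) = m≤n⇒m≤1+n (par≤1 i)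

-- The first two colors of each palette stand in for colors out of range, so they have to exist
-- among any five colors.
palette-par≤4 : ∀ i j → palette i (par j) ≤ 4
palette-par≤4 i 0             = ≤-trans (seed≤2 i) (s≤s (s≤s z≤n))
palette-par≤4 i 1             = s≤s (s≤s (seed≤2 (down i)))
palette-par≤4 i (suc (suc j)) = palette-par≤4 i j

-- A color below i lies in the palette of i or of i + 1 according to its parity, and so does a color
-- above i. Each slot passed lowers c by two; the bound on c limits the slots used when c exceeds i,
-- the bound on i those used when c is below i.
palette-covers : ∀ i c t → c ≢ i → ⌈ c /2⌉ ≤ suc t → ⌈ i /2⌉ ≤ suc t →
                 ∃ λ j → j ≤ t × (palette i j ≡ c ⊎ palette (suc i) j ≡ c)
palette-covers 0 0 t c≢i _ _ = contradiction refl c≢i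
palette-covers 0 1 t _ _ _ = 0 , z≤n , inj₁ refl
palette-covers 0 2 t _ _ _ = 0 , z≤n , inj₂ refl
palette-covers 0 (suc (suc (suc c))) zero _ (s≤s ()) _
palette-covers 0 (suc (suc (suc c))) (suc t) _ (s≤s c≤t) _
  with palette-covers 0 (suc c) t (λ ()) c≤t z≤n
... | j , j≤t , eq = suc j , s≤s j≤t , Sum.map (cong (2 +_)) (cong (2 +_)) eq
palette-covers 1 0 t _ _ _ = 0 , z≤n , inj₂ refl
palette-covers 1 1 t c≢i _ _ = contradiction refl c≢i
palette-covers 1 2 t _ _ _ = 0 , z≤n , inj₁ refl
palette-covers 1 (suc (suc (suc c))) zero _ (s≤s ()) _
palette-covers 1 (suc (suc (suc c))) (suc t) _ (s≤s c≤t) _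
  with palette-covers 0 (suc c) t (λ ()) c≤t z≤n
-- Past the first slot, palettes 1 and 2 are shifts of palettes 1 and 0, the pair for index 0 in
-- reverse order.
... | j , j≤t , eq = suc j , s≤s j≤t , Sum.swap (Sum.map (cong (2 +_)) (cong (2 +_)) eq)
palette-covers (suc (suc i)) 0 t _ _ _ = 0 , z≤n , par-covers i z≤n
palette-covers (suc (suc i)) 1 t _ _ _ = 0 , z≤n , par-covers i ≤-refl
-- With only slot 0 available the bound forces the index to be 2, which is the excluded color
-- itself.
palette-covers (suc (suc i)) (suc (suc zero)) zero c≢i _ (s≤s i≤0) = contradiction i≤0 (positive i c≢i)
  where
  positive : ∀ i → 2 ≢ 2 + i → ¬ ⌈ i /2⌉ ≤ 0
  positive zero    2≢2 _ = 2≢2 refl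
  positive (suc i) _   ()
palette-covers (suc (suc i)) (suc (suc (suc c))) zero _ (s≤s ()) _
palette-covers (suc (suc i)) (suc (suc c)) (suc t) c≢i (s≤s c≤t) (s≤s i≤t)
  with palette-covers i c t (c≢i ∘ cong (2 +_)) c≤t i≤t
... | j , j≤t , eq = suc j , s≤s j≤t , Sum.map (cong (2 +_)) (cong (2 +_)) eq

-- Replacing j by its parity keeps consecutive slots distinct.
module Truncation (k : ℕ) (4<k : 4 < k) where

  truncate : ∀ i j → Dec (palette i j < k) → ℕ
  truncate i j (yes _) = j
  truncate i j (no  _) = par j

  slotIndex : ℕ → ℕ → ℕ
  slotIndex i j = truncate i j (palette i j <? k)

  par-slotIndex : ∀ i j → par (slotIndex i j) ≡ par j
  par-slotIndex i j with palette i j <? k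
  ... | yes _ = refl
  ... | no  _ = par-idem j

  slotIndex-suc : ∀ i j → slotIndex i j ≢ slotIndex i (suc j)
  slotIndex-suc i j eq =
    par-suc j (trans (sym (par-slotIndex i j)) (trans (cong par eq) (par-slotIndex i (suc j))))

  palette-slotIndex< : ∀ i j → palette i (slotIndex i j) < k
  palette-slotIndex< i j with palette i j <? k
  ... | yes p = p
  ... | no  _ = ≤-<-trans (palette-par≤4 i j) 4<k

  slotIndex-id : ∀ i j → palette i j < k → slotIndex i j ≡ j
  slotIndex-id i j p with palette i j <? k
  ... | yes _ = refl
  ... | no ¬p = contradiction p ¬p

-- The first `k` edges get distinct colors and become the b-vertices. All colors are at most 2t + 2,
-- so the t + 1 slots of two adjacent blocks suffice to show them.
many-colors : ∀ {n t} k → 5 ≤ k → k ≤ 2 * t + 3 → suc k ≤ n → HasBColoring (path n ⊡ path t) k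
many-colors {n} {t} (suc k) 5≤k k≤2t+3 k<n =
  color , color-proper E≢Bˡ E≢Bʳ B≢B , bvertex
  where
  open Truncation (suc k) 5≤k
  -- Now `k` is the last color. Since e_k meets blocks k and k + 1, edge indices are capped at `k`
  -- and block indices at `suc k`.
  b : ℕ → ℕ → ℕ
  b i j = palette (i ⊓ suc k) (slotIndex (i ⊓ suc k) j)
  E<k : ∀ i → i ⊓ k < suc k
  E<k i = s≤s (m⊓n≤n i k)
  B<k : ∀ i j → b i j < suc k
  B<k i j = palette-slotIndex< (i ⊓ suc k) j
  E : ℕ → Fin (suc k)
  E i = fromℕ< (E<k i)
  B : ℕ → ℕ → Fin (suc k)
  B i j = fromℕ< (B<k i j)
  open BlockColoring {n} {t} E B

  palette≢last : ∀ i j → palette (i ⊓ suc k) j ≢ i ⊓ k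
  palette≢last i j with i ≤? k
  ... | yes i≤k rewrite m≤n⇒m⊓n≡m i≤k | m≤n⇒m⊓n≡m (m≤n⇒m≤1+n i≤k) = palette≢ˡ i j
  -- Beyond e_k every block repeats block k + 1, so the block on the left avoids color k for the
  -- same reason as the one on the right.
  ... | no  i≰k rewrite m≥n⇒m⊓n≡n (<⇒≤ (≰⇒> i≰k)) | m≥n⇒m⊓n≡n (≰⇒> i≰k) = palette≢ʳ k j

  E≢Bˡ : ∀ i j → E i ≢ B i j
  E≢Bˡ i j eq = palette≢last i (slotIndex (i ⊓ suc k) j) (sym (fromℕ<-injective _ _ (E<k i) (B<k i j) eq))

  E≢Bʳ : ∀ i j → E i ≢ B (suc i) j
  E≢Bʳ i j eq = palette≢ʳ (i ⊓ k) (slotIndex (suc (i ⊓ k)) j) (sym (fromℕ<-injective _ _ (E<k i) (B<k (suc i) j) eq))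

  B≢B : ∀ i j → B i j ≢ B i (suc j)
  B≢B i j eq = slotIndex-suc (i ⊓ suc k) j
    (palette-injective (i ⊓ suc k) (fromℕ<-injective _ _ (B<k i j) (B<k i (suc j)) eq))

  E-toℕ : ∀ c → E (toℕ c) ≡ c
  E-toℕ c = toℕ-injective (trans (toℕ-fromℕ< (E<k (toℕ c))) (m≤n⇒m⊓n≡m (≤-pred (toℕ<n c))))

  B-palette : ∀ i j c → i ≤ suc k → palette i j ≡ toℕ c → B i j ≡ c
  B-palette i j c i≤k eq = toℕ-injective (trans (toℕ-fromℕ< (B<k i j)) b≡c)
    where
    b≡c : b i j ≡ toℕ c
    b≡c rewrite m≤n⇒m⊓n≡m i≤k
              | slotIndex-id i j (subst (_< suc k) (sym eq) (toℕ<n c)) = eq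

  half : ∀ (c : Fin (suc k)) → ⌈ toℕ c /2⌉ ≤ suc t
  half c = ≤-trans (⌈n/2⌉-mono (≤-pred (≤-trans (toℕ<n c)
             (≤-trans k≤2t+3 (≤-reflexive 2t+3≡)))))
             (≤-reflexive (sym (n≡⌈n+n/2⌉ (suc t))))
    where
    2t+3≡ : 2 * t + 3 ≡ suc (suc t + suc t)
    2t+3≡ rewrite +-identityʳ t | +-comm (t + t) 3 | +-suc t t = refl

  bvertex : ∀ c → ∃ (IsBVertex (path n ⊡ path t) color c)
  bvertex c = subst (λ x → ∃ (IsBVertex (path n ⊡ path t) color x)) (E-toℕ c)
    (sub-bvertex (<-≤-trans (s≤s (toℕ<n c)) k<n) covers)
    where
    covers : ∀ d → d ≢ E (toℕ c) →
             ∃ λ j → j ≤ t × (B (toℕ c) j ≡ d ⊎ B (suc (toℕ c)) j ≡ d)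
    covers d d≢ =
      let d≢c = λ eq → d≢ (trans (toℕ-injective eq) (sym (E-toℕ c)))
          j , j≤t , eq = palette-covers (toℕ c) (toℕ d) t d≢c (half d) (half c)
      in j , j≤t , Sum.map (B-palette _ j d (<⇒≤ (toℕ<n c))) (B-palette _ j d (toℕ<n c)) eq

-- Explicit periodic colorings with four and five colors

module _ {k : ℕ} where

  cycle₂ : Fin k → Fin k → ℕ → Fin k
  cycle₂ a b 0             = a
  cycle₂ a b 1             = b
  cycle₂ a b (suc (suc j)) = cycle₂ a b j

  cycle₂-avoids : ∀ {a b d} → d ≢ a → d ≢ b → ∀ j → d ≢ cycle₂ a b j
  cycle₂-avoids d≢a d≢b 0             = d≢a
  cycle₂-avoids d≢a d≢b 1             = d≢b
  cycle₂-avoids d≢a d≢b (suc (suc j)) = cycle₂-avoids d≢a d≢b j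

  cycle₂-alternates : ∀ {a b} → a ≢ b → ∀ j → cycle₂ a b j ≢ cycle₂ a b (suc j)
  cycle₂-alternates a≢b 0             = a≢b
  cycle₂-alternates a≢b 1             = a≢b ∘ sym
  cycle₂-alternates a≢b (suc (suc j)) = cycle₂-alternates a≢b j

  cycle₃ : Fin k → Fin k → Fin k → ℕ → Fin k
  cycle₃ a b c 0                   = a
  cycle₃ a b c 1                   = b
  cycle₃ a b c 2                   = c
  cycle₃ a b c (suc (suc (suc j))) = cycle₃ a b c j

  cycle₃-avoids : ∀ {a b c d} → d ≢ a → d ≢ b → d ≢ c → ∀ j → d ≢ cycle₃ a b c j
  cycle₃-avoids d≢a d≢b d≢c 0                   = d≢a
  cycle₃-avoids d≢a d≢b d≢c 1                   = d≢b
  cycle₃-avoids d≢a d≢b d≢c 2                   = d≢c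
  cycle₃-avoids d≢a d≢b d≢c (suc (suc (suc j))) = cycle₃-avoids d≢a d≢b d≢c j

  cycle₃-alternates : ∀ {a b c} → a ≢ b → b ≢ c → c ≢ a →
                      ∀ j → cycle₃ a b c j ≢ cycle₃ a b c (suc j)
  cycle₃-alternates a≢b b≢c c≢a 0                   = a≢b
  cycle₃-alternates a≢b b≢c c≢a 1                   = b≢c
  cycle₃-alternates a≢b b≢c c≢a 2                   = c≢a
  cycle₃-alternates a≢b b≢c c≢a (suc (suc (suc j))) = cycle₃-alternates a≢b b≢c c≢a j

-- e_0, e_1, e_2 serve colors 0, 1, 2. Colors 3 and 4 are served by the second leaf of copies 1 and
-- 2, which sees two edge colors and two leaf colors.
five-colors : ∀ {n t} → 4 ≤ n → 3 ≤ t → HasBColoring (path n ⊡ path t) 5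
five-colors {n} {t} 4≤n 3≤t = color , color-proper E≢Bˡ E≢Bʳ B≢B , bvertex
  where
  E : ℕ → Fin 5
  E 0 = 0F
  E 1 = 1F
  E 2 = 2F
  E (suc (suc (suc i))) = 0F
  B : ℕ → ℕ → Fin 5
  B 0 = cycle₂ 1F 2F
  B 1 = cycle₃ 2F 3F 4F
  B 2 = cycle₃ 0F 4F 3F
  B (suc (suc (suc i))) = cycle₂ 1F 3F
  open BlockColoring {n} {t} E B

  E≢Bˡ : ∀ i j → E i ≢ B i j
  E≢Bˡ 0 = cycle₂-avoids (λ ()) (λ ())
  E≢Bˡ 1 = cycle₃-avoids (λ ()) (λ ()) (λ ())
  E≢Bˡ 2 = cycle₃-avoids (λ ()) (λ ()) (λ ())
  E≢Bˡ (suc (suc (suc i))) = cycle₂-avoids (λ ()) (λ ())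

  E≢Bʳ : ∀ i j → E i ≢ B (suc i) j
  E≢Bʳ 0 = cycle₃-avoids (λ ()) (λ ()) (λ ())
  E≢Bʳ 1 = cycle₃-avoids (λ ()) (λ ()) (λ ())
  E≢Bʳ 2 = cycle₂-avoids (λ ()) (λ ())
  E≢Bʳ (suc (suc (suc i))) = cycle₂-avoids (λ ()) (λ ())

  B≢B : ∀ i j → B i j ≢ B i (suc j)
  B≢B 0 = cycle₂-alternates (λ ())
  B≢B 1 = cycle₃-alternates (λ ()) (λ ()) (λ ())
  B≢B 2 = cycle₃-alternates (λ ()) (λ ()) (λ ())
  B≢B (suc (suc (suc i))) = cycle₂-alternates (λ ())

  0≤t : 0 ≤ t
  0≤t = z≤n
  2≤t : 2 ≤ t
  2≤t = ≤-trans (n≤1+n 2) 3≤t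
  1≤t : 1 ≤ t
  1≤t = ≤-trans (n≤1+n 1) 2≤t
  3≤n : 3 ≤ n
  3≤n = ≤-trans (n≤1+n 3) 4≤n

  bvertex : ∀ c → ∃ (IsBVertex (path n ⊡ path t) color c)
  bvertex 0F = sub-bvertex {0} (≤-trans (n≤1+n 2) 3≤n) λ where
    0F 0≢0 → contradiction refl 0≢0
    1F _   → 0 , 0≤t , inj₁ refl
    2F _   → 0 , 0≤t , inj₂ refl
    3F _   → 1 , 1≤t , inj₂ refl
    4F _   → 2 , 2≤t , inj₂ refl
  bvertex 1F = sub-bvertex {1} 3≤n λ where
    0F _   → 0 , 0≤t , inj₂ refl
    1F 1≢1 → contradiction refl 1≢1
    2F _   → 0 , 0≤t , inj₁ refl
    3F _   → 1 , 1≤t , inj₁ refl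
    4F _   → 2 , 2≤t , inj₁ refl
  bvertex 2F = sub-bvertex {2} 4≤n λ where
    0F _   → 0 , 0≤t , inj₁ refl
    1F _   → 0 , 0≤t , inj₂ refl
    2F 2≢2 → contradiction refl 2≢2
    3F _   → 1 , 1≤t , inj₂ refl
    4F _   → 1 , 1≤t , inj₁ refl
  bvertex 3F = leaf-bvertex {0} {1} 3≤n 2≤t λ where
    0F _   → inj₁ (inj₁ refl)
    1F _   → inj₁ (inj₂ refl)
    2F _   → inj₂ (0 , 1≤t , inj₂ refl , refl)
    3F 3≢3 → contradiction refl 3≢3
    4F _   → inj₂ (2 , 3≤t , inj₁ refl , refl)
  bvertex 4F = leaf-bvertex {1} {1} 4≤n 2≤t λ where
    0F _   → inj₂ (0 , 1≤t , inj₂ refl , refl)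
    1F _   → inj₁ (inj₁ refl)
    2F _   → inj₁ (inj₂ refl)
    3F _   → inj₂ (2 , 3≤t , inj₁ refl , refl)
    4F 4≢4 → contradiction refl 4≢4

-- Only two subdivision vertices exist, so colors 2, 3, 4 are served by three consecutive inner
-- leaves of the middle copy, colored 4, 2, 3, 4, 2 from its start; this takes five leaves.
five-colors-P₃ : ∀ {t} → 5 ≤ t → HasBColoring (path 3 ⊡ path t) 5
five-colors-P₃ {t} 5≤t = color , color-proper E≢Bˡ E≢Bʳ B≢B , bvertex
  where
  E : ℕ → Fin 5
  E 0       = 0F
  E (suc i) = 1F
  B : ℕ → ℕ → Fin 5
  B 0             = cycle₂ 1F 2F
  B 1             = cycle₃ 4F 2F 3F
  B (suc (suc i)) = cycle₂ 0F 2F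
  open BlockColoring {3} {t} E B

  E≢Bˡ : ∀ i j → E i ≢ B i j
  E≢Bˡ 0             = cycle₂-avoids (λ ()) (λ ())
  E≢Bˡ 1             = cycle₃-avoids (λ ()) (λ ()) (λ ())
  E≢Bˡ (suc (suc i)) = cycle₂-avoids (λ ()) (λ ())

  E≢Bʳ : ∀ i j → E i ≢ B (suc i) j
  E≢Bʳ 0       = cycle₃-avoids (λ ()) (λ ()) (λ ())
  E≢Bʳ (suc i) = cycle₂-avoids (λ ()) (λ ())

  B≢B : ∀ i j → B i j ≢ B i (suc j)
  B≢B 0             = cycle₂-alternates (λ ())
  B≢B 1             = cycle₃-alternates (λ ()) (λ ()) (λ ())
  B≢B (suc (suc i)) = cycle₂-alternates (λ ())

  4≤t : 4 ≤ t
  4≤t = ≤-trans (n≤1+n 4) 5≤t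
  3≤t : 3 ≤ t
  3≤t = ≤-trans (n≤1+n 3) 4≤t
  2≤t : 2 ≤ t
  2≤t = ≤-trans (n≤1+n 2) 3≤t
  1≤t : 1 ≤ t
  1≤t = ≤-trans (n≤1+n 1) 2≤t

  bvertex : ∀ c → ∃ (IsBVertex (path 3 ⊡ path t) color c)
  bvertex 0F = sub-bvertex {0} (n≤1+n 2) λ where
    0F 0≢0 → contradiction refl 0≢0
    1F _   → 0 , z≤n , inj₁ refl
    2F _   → 1 , 1≤t , inj₁ refl
    3F _   → 2 , 2≤t , inj₂ refl
    4F _   → 0 , z≤n , inj₂ refl
  bvertex 1F = sub-bvertex {1} ≤-refl λ where
    0F _   → 0 , z≤n , inj₂ refl
    1F 1≢1 → contradiction refl 1≢1
    2F _   → 1 , 1≤t , inj₁ refl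
    3F _   → 2 , 2≤t , inj₁ refl
    4F _   → 0 , z≤n , inj₁ refl
  bvertex 2F = leaf-bvertex {0} {1} ≤-refl 2≤t λ where
    0F _   → inj₁ (inj₁ refl)
    1F _   → inj₁ (inj₂ refl)
    2F 2≢2 → contradiction refl 2≢2
    3F _   → inj₂ (2 , 3≤t , inj₁ refl , refl)
    4F _   → inj₂ (0 , 1≤t , inj₂ refl , refl)
  bvertex 3F = leaf-bvertex {0} {2} ≤-refl 3≤t λ where
    0F _   → inj₁ (inj₁ refl)
    1F _   → inj₁ (inj₂ refl)
    2F _   → inj₂ (1 , 2≤t , inj₂ refl , refl)
    3F 3≢3 → contradiction refl 3≢3
    4F _   → inj₂ (3 , 4≤t , inj₁ refl , refl)
  bvertex 4F = leaf-bvertex {0} {3} ≤-refl 4≤t λ where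
    0F _   → inj₁ (inj₁ refl)
    1F _   → inj₁ (inj₂ refl)
    2F _   → inj₂ (4 , 5≤t , inj₁ refl , refl)
    3F _   → inj₂ (2 , 3≤t , inj₂ refl , refl)
    4F 4≢4 → contradiction refl 4≢4

-- The first two leaves of the middle copy, colored 2 and 3, see each other and both edge colors.
four-colors-P₃ : ∀ {t} → 2 ≤ t → HasBColoring (path 3 ⊡ path t) 4
four-colors-P₃ {t} 2≤t = color , color-proper E≢Bˡ E≢Bʳ B≢B , bvertex
  where
  E : ℕ → Fin 4
  E 0       = 0F
  E (suc i) = 1F
  B : ℕ → ℕ → Fin 4
  B 0             = cycle₂ 1F 2F
  B 1             = cycle₂ 2F 3F
  B (suc (suc i)) = cycle₂ 0F 2F
  open BlockColoring {3} {t} E B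

  E≢Bˡ : ∀ i j → E i ≢ B i j
  E≢Bˡ 0             = cycle₂-avoids (λ ()) (λ ())
  E≢Bˡ 1             = cycle₂-avoids (λ ()) (λ ())
  E≢Bˡ (suc (suc i)) = cycle₂-avoids (λ ()) (λ ())

  E≢Bʳ : ∀ i j → E i ≢ B (suc i) j
  E≢Bʳ 0       = cycle₂-avoids (λ ()) (λ ())
  E≢Bʳ (suc i) = cycle₂-avoids (λ ()) (λ ())

  B≢B : ∀ i j → B i j ≢ B i (suc j)
  B≢B 0             = cycle₂-alternates (λ ())
  B≢B 1             = cycle₂-alternates (λ ())
  B≢B (suc (suc i)) = cycle₂-alternates (λ ())

  1≤t : 1 ≤ t
  1≤t = ≤-trans (n≤1+n 1) 2≤t

  bvertex : ∀ c → ∃ (IsBVertex (path 3 ⊡ path t) color c)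
  bvertex 0F = sub-bvertex {0} (n≤1+n 2) λ where
    0F 0≢0 → contradiction refl 0≢0
    1F _   → 0 , z≤n , inj₁ refl
    2F _   → 0 , z≤n , inj₂ refl
    3F _   → 1 , 1≤t , inj₂ refl
  bvertex 1F = sub-bvertex {1} ≤-refl λ where
    0F _   → 0 , z≤n , inj₂ refl
    1F 1≢1 → contradiction refl 1≢1
    2F _   → 0 , z≤n , inj₁ refl
    3F _   → 1 , 1≤t , inj₁ refl
  bvertex 2F = leaf-bvertex {0} {0} ≤-refl 1≤t λ where
    0F _   → inj₁ (inj₁ refl)
    1F _   → inj₁ (inj₂ refl)
    2F 2≢2 → contradiction refl 2≢2
    3F _   → inj₂ (1 , 2≤t , inj₁ refl , refl)
  bvertex 3F = leaf-bvertex {0} {1} ≤-refl 2≤t λ where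
    0F _   → inj₁ (inj₁ refl)
    1F _   → inj₁ (inj₂ refl)
    2F _   → inj₂ (0 , 1≤t , inj₂ refl , refl)
    3F 3≢3 → contradiction refl 3≢3

-- Upper bounds

-- The code together with one further value, taken at the color i, embeds the
-- colors into 1 + A.
neighbor-bound : ∀ (G : Graph) {l} {c : V G → Fin l} {i v} {A : Set} (finA : Finite A)
                 (code : V G → A) →
                 (∀ {w w′} → Adj G v w → Adj G v w′ → code w ≡ code w′ → w ≡ w′) →
                 IsBVertex G c i v → l ≤ suc (proj₁ finA)
neighbor-bound G {l} {c} {i} {v} (d , A↔) code code-inj (_ , neighbor) =
  injective⇒≤ {f = λ j → embed j (j Fin.≟ i)} (embed-injective _ _ (_ Fin.≟ i) (_ Fin.≟ i))
  where
  embed : ∀ j → Dec (j ≡ i) → Fin (suc d)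
  embed j (yes _)   = Fin.zero
  embed j (no  j≢i) = Fin.suc (Inverse.to A↔ (code (proj₁ (neighbor j j≢i))))
  embed-injective : ∀ j j′ (j? : Dec (j ≡ i)) (j′? : Dec (j′ ≡ i)) →
                    embed j j? ≡ embed j′ j′? → j ≡ j′
  embed-injective j j′ (yes j≡i) (yes j′≡i) eq = trans j≡i (sym j′≡i)
  embed-injective j j′ (no j≢i) (no j′≢i) eq
    with neighbor j j≢i | neighbor j′ j′≢i
  ... | w , v~w , cw≡j | w′ , v~w′ , cw′≡j′ =
    trans (sym cw≡j) (trans (cong c w≡w′) cw′≡j′)
    where
    w≡w′ : w ≡ w′
    w≡w′ = code-inj v~w v~w′ (Injection.injective (↔⇒↣ A↔) (Fin-suc-injective eq))

-- Degree bounds through codes of neighbors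

module _ {n : ℕ} where

  -- One code with two uses: for a fixed edge it separates the endpoints, for a fixed vertex the
  -- incident edges.
  side : Fin n → Edge (path n) → Fin 2
  side u e with u Fin.≟ left e
  ... | yes _ = 0F
  ... | no  _ = 1F

  side-incident : ∀ {u e} → _∈ᵉ_ (path n) u e →
                  (side u e ≡ 0F × u ≡ left e) ⊎ (side u e ≡ 1F × u ≡ right e)
  side-incident {u} {e} p with u Fin.≟ left e
  ... | yes eq = inj₁ (refl , eq)
  side-incident (inj₁ eq) | no u≢ = contradiction eq u≢
  side-incident (inj₂ eq) | no _  = inj₂ (refl , eq)

  side-injectiveˡ : ∀ {u v e} → _∈ᵉ_ (path n) u e → _∈ᵉ_ (path n) v e →
                    side u e ≡ side v e → u ≡ v
  side-injectiveˡ p q eq with side-incident p | side-incident q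
  ... | inj₁ (_ , u≡) | inj₁ (_ , v≡) = trans u≡ (sym v≡)
  ... | inj₂ (_ , u≡) | inj₂ (_ , v≡) = trans u≡ (sym v≡)
  ... | inj₁ (s≡ , _) | inj₂ (r≡ , _) = contradiction (trans (sym s≡) (trans eq r≡)) λ ()
  ... | inj₂ (s≡ , _) | inj₁ (r≡ , _) = contradiction (trans (sym s≡) (trans eq r≡)) λ ()

  side-injectiveʳ : ∀ {u e f} → _∈ᵉ_ (path n) u e → _∈ᵉ_ (path n) u f →
                    side u e ≡ side u f → e ≡ f
  side-injectiveʳ {u} {e} {f} p q eq with side-incident {u} {e} p | side-incident {u} {f} q
  ... | inj₁ (_ , u≡) | inj₁ (_ , v≡) = left-injective (trans (sym u≡) v≡)
  ... | inj₂ (_ , u≡) | inj₂ (_ , v≡) = right-injective (trans (sym u≡) v≡)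
  ... | inj₁ (s≡ , _) | inj₂ (r≡ , _) = contradiction (trans (sym s≡) (trans eq r≡)) λ ()
  ... | inj₂ (s≡ , _) | inj₁ (r≡ , _) = contradiction (trans (sym s≡) (trans eq r≡)) λ ()

  direction : Fin n → Fin n → Fin 2
  direction h h′ with suc (toℕ h) ≟ toℕ h′
  ... | yes _ = 0F
  ... | no  _ = 1F

  direction-injective : ∀ {h h′ h″} → Adj (path n) h h′ → Adj (path n) h h″ →
                        direction h h′ ≡ direction h h″ → h′ ≡ h″
  direction-injective {h} {h′} {h″} p q eq
    with suc (toℕ h) ≟ toℕ h′ | suc (toℕ h) ≟ toℕ h″
  ... | yes e₁ | yes e₂ = toℕ-injective (trans (sym e₁) e₂)
  direction-injective (inj₂ p) (inj₂ q) _ | no _ | no _ =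
    toℕ-injective (suc-injective (trans p (sym q)))
  direction-injective (inj₁ p) _ _ | no ¬p | no _  = contradiction p ¬p
  direction-injective _ (inj₁ q) _ | no _  | no ¬q = contradiction q ¬q

module _ {n t l : ℕ} {c : V (path n ⊡ path t) → Fin l} where

  private
    G = path n ⊡ path t

  branch-bound : ∀ {i u} → IsBVertex G c i (branch u) → l ≤ 3
  branch-bound {u = u} = neighbor-bound G (finite-Fin 2) code injective
    where
    code : V G → Fin 2
    code (sub e) = side u e
    -- A placeholder: all neighbors of a branch vertex are subdivision vertices.
    code _       = 0F
    injective : ∀ {w w′} → Adj G (branch u) w → Adj G (branch u) w′ → code w ≡ code w′ → w ≡ w′
    injective {sub e} {sub f} p q eq = cong sub (side-injectiveʳ {e = e} {f} p q eq)

  -- The codes `p` and `q` are parameters so that a leaf at an end of either path can use `Fin 1`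
  -- and obtain a sharper bound.
  leaf-bound : ∀ {i u h a b} (p : Edge (path n) → Fin a) (q : Fin t → Fin b) →
               (∀ {e f} → _∈ᵉ_ (path n) u e → _∈ᵉ_ (path n) u f → p e ≡ p f → e ≡ f) →
               (∀ {h′ h″} → Adj (path t) h h′ → Adj (path t) h h″ → q h′ ≡ q h″ → h′ ≡ h″) →
               IsBVertex G c i (leaf u h) → l ≤ suc (a + b)
  leaf-bound {u = u} {h} {a} {b} p q p-inj q-inj =
    neighbor-bound G (finite-⊎ (finite-Fin a) (finite-Fin b)) code injective
    where
    code : V G → Fin a ⊎ Fin b
    code (branch _) = inj₂ (q h)
    code (sub e)    = inj₁ (p e)
    code (leaf _ h) = inj₂ (q h)
    injective : ∀ {w w′} → Adj G (leaf u h) w → Adj G (leaf u h) w′ → code w ≡ code w′ → w ≡ w′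
    injective {sub e} {sub f} u∈e u∈f eq = cong sub (p-inj u∈e u∈f (inj₁-injective eq))
    injective {leaf _ _} {leaf _ _} (refl , h~h′) (refl , h~h″) eq =
      cong (leaf u) (q-inj h~h′ h~h″ (inj₂-injective eq))
    injective {sub _} {leaf _ _} _ _ ()
    injective {leaf _ _} {sub _} _ _ ()

  -- A neighbor is coded by an endpoint of the edge and one of t + 1 slots, the last slot being the
  -- branch vertex.
  sub-bound : ∀ {i e} → IsBVertex G c i (sub e) → l ≤ 2 * t + 3
  sub-bound {e = e} b = ≤-trans
    (neighbor-bound G (finite-× (finite-Fin 2) (finite-Fin (suc t))) code injective b)
    (≤-reflexive 3+2t)
    where
    code : V G → Fin 2 × Fin (suc t)
    code (branch u) = side u e , fromℕ t
    code (sub _)    = 0F , fromℕ t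
    code (leaf u h) = side u e , inject₁ h
    injective : ∀ {w w′} → Adj G (sub e) w → Adj G (sub e) w′ → code w ≡ code w′ → w ≡ w′
    injective {branch u} {branch v} p q eq = cong branch (side-injectiveˡ p q (,-injectiveˡ eq))
    injective {leaf u h} {leaf v h′} p q eq =
      cong₂ leaf (side-injectiveˡ p q (,-injectiveˡ eq)) (inject₁-injective (,-injectiveʳ eq))
    injective {branch u} {leaf v h} p q eq = contradiction (,-injectiveʳ eq) fromℕ≢inject₁
    injective {leaf u h} {branch v} p q eq = contradiction (sym (,-injectiveʳ eq)) fromℕ≢inject₁
    3+2t : suc (2 * suc t) ≡ 2 * t + 3
    3+2t rewrite +-identityʳ t | +-comm (t + t) 3 | +-suc t t = refl

  -- Six colors require degree 5, whereas branch vertices have degree at most 2 and leaves at most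
  -- 4.
  bvertex-sub : 6 ≤ l → ∀ {i} → ∃ (IsBVertex G c i) → ∃ λ e → IsBVertex G c i (sub e)
  bvertex-sub 6≤l (sub e , b)    = e , b
  bvertex-sub 6≤l (branch u , b) =
    contradiction (≤-trans 6≤l (branch-bound b)) λ { (s≤s (s≤s (s≤s ()))) }
  bvertex-sub 6≤l (leaf u h , b) =
    contradiction (≤-trans 6≤l (leaf-bound (side u) (direction h) side-injectiveʳ direction-injective b))
      λ { (s≤s (s≤s (s≤s (s≤s (s≤s ()))))) }

-- With six or more colors, b-vertices of distinct colors are distinct subdivision vertices, of
-- which there are n - 1; the degree of any one of them gives the other bound.
colors-bound : ∀ {n t l} → HasBColoring (path n ⊡ path t) l →
               l ≤ 5 ⊎ (l ≤ n ∸ 1 × l ≤ 2 * t + 3)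
colors-bound {n} {t} {l} (c , _ , bvertex) with l ≤? 5
... | yes l≤5 = inj₁ l≤5
... | no  l≰5 = inj₂ (injective⇒≤ {f = f} f-injective , sub-bound (proj₂ (bsub (fromℕ< 0<l))))
  where
  0<l : 0 < l
  0<l = ≤-trans z<s (≰⇒> l≰5)
  bsub : ∀ i → ∃ λ e → IsBVertex (path n ⊡ path t) c i (sub e)
  bsub i = bvertex-sub (≰⇒> l≰5) (bvertex i)
  f : Fin l → Fin (n ∸ 1)
  f i = fromℕ< (left-bound (proj₁ (bsub i)))
  f-injective : ∀ {i j} → f i ≡ f j → i ≡ j
  f-injective {i} {j} eq with bsub i | bsub j
  ... | e , ce≡i , _ | e′ , ce′≡j , _ =
    trans (sym ce≡i) (trans (cong (c ∘ sub) (left-injective (toℕ-injective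
      (fromℕ<-injective _ _ (left-bound e) (left-bound e′) eq)))) ce′≡j)

-- Possible b-vertices for five colors when n = 3

module _ {t : ℕ} where

  private
    G = path 3 ⊡ path t

  Core : V G → Set
  Core (branch u) = ⊥
  Core (sub e)    = ⊤
  Core (leaf u h) = u ≡ 1F × toℕ h ≢ 0 × suc (toℕ h) ≢ t

  -- Every other vertex has degree at most 3.
  bvertex-core : ∀ {l} {c : V G → Fin l} → 5 ≤ l → ∀ {i v} → IsBVertex G c i v → Core v
  bvertex-core 5≤l {v = branch u} b =
    contradiction (≤-trans 5≤l (branch-bound b)) λ { (s≤s (s≤s (s≤s ()))) }
  bvertex-core 5≤l {v = sub e} b = tt
  bvertex-core {l} {c} 5≤l {v = leaf u h} b = middle u b , first , last
    where
    absurd : ¬ l ≤ 4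
    absurd l≤4 = contradiction (≤-trans 5≤l l≤4) λ { (s≤s (s≤s (s≤s (s≤s ())))) }

    middle : ∀ u {i} → IsBVertex G c i (leaf u h) → u ≡ 1F
    middle 1F b = refl
    -- An end of P_3 lies on a single edge, so `Fin 1` codes the edges and the bound drops to 1 + (1
    -- + 2) = 4.
    middle 0F b = contradiction
      (leaf-bound {a = 1} (λ _ → 0F) (direction h) injective direction-injective b) absurd
      where
      at-left : ∀ {e} → _∈ᵉ_ (path 3) 0F e → 0F ≡ left e
      at-left (inj₁ eq) = eq
      at-left {e} (inj₂ eq) = contradiction (trans (suc-left e) (cong toℕ (sym eq))) λ ()
      injective : ∀ {e f} → _∈ᵉ_ (path 3) 0F e → _∈ᵉ_ (path 3) 0F f → _ → e ≡ f
      injective {e} {f} p q _ = left-injective (trans (sym (at-left {e} p)) (at-left {f} q))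
    middle 2F b = contradiction
      (leaf-bound {a = 1} (λ _ → 0F) (direction h) injective direction-injective b) absurd
      where
      at-right : ∀ {e} → _∈ᵉ_ (path 3) 2F e → 2F ≡ right e
      at-right {e} (inj₁ refl) = contradiction (left-bound e) λ { (s≤s (s≤s ())) }
      at-right (inj₂ eq) = eq
      injective : ∀ {e f} → _∈ᵉ_ (path 3) 2F e → _∈ᵉ_ (path 3) 2F f → _ → e ≡ f
      injective {e} {f} p q _ = right-injective (trans (sym (at-right {e} p)) (at-right {f} q))

    first : toℕ h ≢ 0
    -- An end of the copy has at most one neighbor in it, so here `Fin 1` codes the leaves.
    first h≡0 = absurd (leaf-bound {b = 1} (side u) (λ _ → 0F) side-injectiveʳ injective b)
      where
      next : ∀ {h′} → Adj (path t) h h′ → 1 ≡ toℕ h′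
      next (inj₁ eq) = trans (cong suc (sym h≡0)) eq
      next (inj₂ eq) = contradiction (trans eq h≡0) λ ()
      injective : ∀ {h′ h″} → Adj (path t) h h′ → Adj (path t) h h″ → _ → h′ ≡ h″
      injective p q _ = toℕ-injective (trans (sym (next p)) (next q))

    last : suc (toℕ h) ≢ t
    last h≡t = absurd (leaf-bound {b = 1} (side u) (λ _ → 0F) side-injectiveʳ injective b)
      where
      previous : ∀ {h′} → Adj (path t) h h′ → suc (toℕ h′) ≡ toℕ h
      previous {h′} (inj₁ eq) = contradiction (toℕ<n h′) (<-irrefl (trans (sym eq) h≡t))
      previous (inj₂ eq) = eq
      injective : ∀ {h′ h″} → Adj (path t) h h′ → Adj (path t) h h″ → _ → h′ ≡ h″
      injective p q _ = toℕ-injective (suc-injective (trans (previous p) (sym (previous q))))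

  -- Numbers the core: the two subdivision vertices get 0 and 1, and inner leaves, at position 1 or
  -- later, continue from 2. The value at a branch vertex is a placeholder.
  code : V G → ℕ
  code (branch u) = 0
  code (sub e)    = toℕ (left e)
  code (leaf u h) = suc (toℕ h)

  code-bound : t ≤ 4 → ∀ v → Core v → code v < 4
  code-bound t≤4 (sub e)    _ = ≤-trans (left-bound e) (s≤s (s≤s z≤n))
  code-bound t≤4 (leaf u h) (_ , _ , h≢last) = ≤-trans (≤∧≢⇒< (toℕ<n h) h≢last) t≤4

  code-sub≢leaf : ∀ (e : Edge (path 3)) {u h} → Core (leaf u h) → toℕ (left e) ≢ suc (toℕ h)
  code-sub≢leaf e (_ , h≢0 , _) eq =
    h≢0 (n<1⇒n≡0 (≤-pred (subst (_< 2) eq (left-bound e))))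

  code-injective : ∀ v w → Core v → Core w → code v ≡ code w → v ≡ w
  code-injective (sub e)    (sub f)    _ _ eq = cong sub (left-injective (toℕ-injective eq))
  code-injective (leaf u h) (leaf v k) (refl , _) (refl , _) eq =
    cong (leaf 1F) (toℕ-injective (suc-injective eq))
  code-injective (sub e)    (leaf u h) _ q eq = contradiction eq (code-sub≢leaf e q)
  code-injective (leaf u h) (sub e)    p _ eq = contradiction (sym eq) (code-sub≢leaf e p)

-- Five colors would need five core vertices, but `code` embeds the core into four numbers.
colors-bound-P₃ : ∀ {t l} → t ≤ 4 → HasBColoring (path 3 ⊡ path t) l → l ≤ 4
colors-bound-P₃ {t} {l} t≤4 (c , _ , bvertex) with l ≤? 4
... | yes l≤4 = l≤4
... | no  l≰4 = injective⇒≤ {f = f} f-injective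
  where
  core : ∀ i → Core (proj₁ (bvertex i))
  core i = bvertex-core (≰⇒> l≰4) (proj₂ (bvertex i))
  bound : ∀ i → code (proj₁ (bvertex i)) < 4
  bound i = code-bound t≤4 (proj₁ (bvertex i)) (core i)
  f : Fin l → Fin 4
  f i = fromℕ< (bound i)
  f-injective : ∀ {i j} → f i ≡ f j → i ≡ j
  f-injective {i} {j} eq = trans (sym (proj₁ (proj₂ (bvertex i)))) (trans
    (cong c (code-injective _ _ (core i) (core j) (fromℕ<-injective _ _ (bound i) (bound j) eq)))
    (proj₁ (proj₂ (bvertex j))))

-- Matching the bounds in the four cases

theorem6 : ∀ (n t : ℕ) → n > 2 → t > 2 →
  let case₁ = n ≡ 3 × (t ≡ 3 ⊎ t ≡ 4)
      case₂ = (n ≡ 3 × t ≥ 5) ⊎ (n ≡ 4 ⊎ n ≡ 5)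
      case₃ = 6 ≤ n × n ≤ 2 * t + 3
      G     = path n ⊡ path t
  in (case₁ → φ G ≔ 4)
   × (case₂ → φ G ≔ 5)
   × (case₃ → φ G ≔ n ∸ 1)
   × (¬ case₁ × ¬ case₂ × ¬ case₃ → φ G ≔ 2 * t + 3)
theorem6 n t n>2 t>2 = one , two , three , otherwise
  where
  G = path n ⊡ path t

  5≤2t+3 : 5 ≤ 2 * t + 3
  5≤2t+3 = +-mono-≤ {2} (≤-trans (≤-trans (n≤1+n 2) t>2) (m≤m+n t _)) ≤-refl

  at-most-5 : n ≤ 5 → ∀ l → HasBColoring G l → l ≤ 5
  at-most-5 n≤5 l h with colors-bound h
  ... | inj₁ l≤5       = l≤5
  ... | inj₂ (l<n , _) = ≤-trans l<n (≤-trans (m∸n≤m n 1) n≤5)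

  one : n ≡ 3 × (t ≡ 3 ⊎ t ≡ 4) → φ G ≔ 4
  one (refl , t≡) = four-colors-P₃ (<⇒≤ t>2) , λ l → colors-bound-P₃ (t≤4 t≡)
    where
    t≤4 : t ≡ 3 ⊎ t ≡ 4 → t ≤ 4
    t≤4 (inj₁ refl) = n≤1+n 3
    t≤4 (inj₂ refl) = ≤-refl

  two : (n ≡ 3 × t ≥ 5) ⊎ (n ≡ 4 ⊎ n ≡ 5) → φ G ≔ 5
  two (inj₁ (refl , t≥5)) = five-colors-P₃ t≥5 , at-most-5 (s≤s (s≤s (s≤s z≤n)))
  two (inj₂ (inj₁ refl))  = five-colors ≤-refl t>2 , at-most-5 (n≤1+n 4)
  two (inj₂ (inj₂ refl))  = five-colors (n≤1+n 4) t>2 , at-most-5 ≤-refl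

  three : 6 ≤ n × n ≤ 2 * t + 3 → φ G ≔ n ∸ 1
  three (6≤n , n≤2t+3) =
    -- Every edge of the path receives a color of its own.
    many-colors (n ∸ 1) 5≤n∸1 (≤-trans (m∸n≤m n 1) n≤2t+3)
      (≤-reflexive (m+[n∸m]≡n (≤-trans (s≤s z≤n) n>2))) ,
    λ l h → [ (λ l≤5 → ≤-trans l≤5 5≤n∸1) , proj₁ ]′ (colors-bound h)
    where
    5≤n∸1 : 5 ≤ n ∸ 1
    5≤n∸1 = ∸-monoˡ-≤ 1 6≤n

  otherwise : _ → φ G ≔ 2 * t + 3
  otherwise (¬one , ¬two , ¬three) =
    many-colors (2 * t + 3) 5≤2t+3 ≤-refl (≰⇒> λ n≤2t+3 → ¬three (6≤n , n≤2t+3)) ,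
    λ l h → [ (λ l≤5 → ≤-trans l≤5 5≤2t+3) , proj₂ ]′ (colors-bound h)
    where
    -- For n = 3 every t > 2 falls under one of the first two cases.
    n≢3 : 3 ≢ n
    n≢3 refl with m≤n⇒m<n∨m≡n t>2
    ... | inj₂ refl = ¬one (refl , inj₁ refl)
    ... | inj₁ t>3 with m≤n⇒m<n∨m≡n t>3
    ...   | inj₂ refl = ¬one (refl , inj₂ refl)
    ...   | inj₁ t>4  = ¬two (inj₁ (refl , t>4))
    6≤n : 6 ≤ n
    6≤n = ≤∧≢⇒< (≤∧≢⇒< (≤∧≢⇒< n>2 n≢3)
      (λ n≡4 → ¬two (inj₂ (inj₁ (sym n≡4))))) (λ n≡5 → ¬two (inj₂ (inj₂ (sym n≡5))))
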